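{- Let $G$ be a finite simple undirected graph on $n$ vertices and let $k$ be an integer with $2 \leq k \leq n$ such that $G$ is $k$-ordered. Then $c(G) \geq \min\{n, 2k\}$.
   Context: $G$ is $k$-ordered if for every sequence $(v_1, \ldots, v_k)$ of $k$ distinct vertices of $G$ there is a cycle of $G$ containing $v_1, \ldots, v_k$ in that cyclic order (possibly together with other vertices). The circumference $c(G)$ is the length of a longest cycle in $G$. -}

module Defs where

open import Level using (Level; 0ℓ)
open import Data.Nat using (ℕ; zero; suc; _≤_; _<_)
open import Data.Fin using (Fin; toℕ)
open import Data.Product using (Σ; _×_; ∃-syntax)
open import Relation.Binary.PropositionalEquality using (_≡_)
open import Relation.Nullary using (¬_)
open import Function.Definitions using (Injective)

record SimpleGraph (n : ℕ) : Set₁ where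
  field
    Adj     : Fin n → Fin n → Set
    symm    : ∀ {u v} → Adj u v → Adj v u
    irrefl  : ∀ {v} → ¬ Adj v v
open SimpleGraph public

record Cycle {n : ℕ} (G : SimpleGraph n) (m : ℕ) : Set where
  field
    len≥3   : 3 ≤ m
    vert    : Fin m → Fin n
    inj     : Injective _≡_ _≡_ vert
    step    : ∀ (i j : Fin m) → suc (toℕ i) ≡ toℕ j → Adj G (vert i) (vert j)
    close   : ∀ (i j : Fin m) → suc (toℕ i) ≡ m → toℕ j ≡ 0 → Adj G (vert i) (vert j)
open Cycle public

-- G is k-ordered: for every sequence v_1..v_k of distinct vertices there is a
-- cycle containing them in that cyclic order. Since a cycle may be rotated and
-- reversed, this is the same as: some cycle (as an oriented, rooted sequence)
-- has v_1, ..., v_k at strictly increasing positions.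
KOrdered : {n : ℕ} → SimpleGraph n → ℕ → Set
KOrdered {n} G k =
  ∀ (v : Fin k → Fin n) → Injective _≡_ _≡_ v →
    ∃[ m ] Σ (Cycle G m) λ C → Σ (Fin k → Fin m) λ p → ((∀ (i : Fin k) → vert C (p i) ≡ v i) ×
       (∀ (i j : Fin k) → toℕ i < toℕ j → toℕ (p i) < toℕ (p j)))

CircumferenceAtLeast : {n : ℕ} → SimpleGraph n → ℕ → Set
CircumferenceAtLeast G L = ∃[ m ] (L ≤ m × Cycle G m)

-- Let C be a longest cycle, suppose |C| < min (n , 2k), and let x lie off C, in the component H of
-- G − C. Let S be the set of neighbours of H on C. No two consecutive vertices of C are in S, so S cuts
-- C into blocks, each a vertex of S followed by a nonempty gap, and |S| ≤ k − 1.
-- If |S| ≤ k − 2, take b ∈ C ∖ S: a cycle through x, b and then all of S, in this order, would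
-- have an arc from x to b avoiding S, which is impossible.
-- If |S| = k − 1, all gaps but at most one are single vertices and the remaining one has at most
-- two. By the standard crossing argument distinct gaps lie in distinct components of G − S, so
-- the k vertices consisting of x and one vertex of each gap are pairwise separated by S, and no
-- cycle through all of them exists, since its k arcs would need k distinct vertices of S.
module Submission where

open import Defs
open import Data.Nat using (ℕ; zero; suc; pred; _+_; _∸_; _*_; _⊓_; _≤_; _<_; _≤?_;
  z≤n; s≤s; z<s; s<s⁻¹; s≤s⁻¹)
open import Data.Nat.Properties hiding (_≟_)
open import Data.Fin using (Fin; zero; suc; toℕ; fromℕ; inject₁; inject≤)
open import Data.Fin.Properties 
  using (_≟_; any?; injective⇒≤; toℕ-inject₁; toℕ-fromℕ; inject≤-injective)
open import Data.List
  using (List; []; _∷_; [_]; _++_; length; map; reverse; lookup; tabulate; filter; allFin)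
open import Data.List.Properties
  using (length-++; ++-identityʳ; tabulate-cong; ++-assoc; filter-++; filter-some; unfold-reverse;
    length-tabulate; length-map; tabulate-lookup; reverse-++)
open import Data.List.Membership.Propositional using (_∈_; _∉_; find; lose)
open import Data.List.Membership.Propositional.Properties
  using (∈-lookup; ∈-length; ∈-∃++; ∈-++⁺ˡ; ∈-++⁺ʳ; ∈-++⁻; ∈-filter⁻; ∈-insert; ∈-map⁺)
open import Data.List.Relation.Unary.Any as Any using (Any; here; there; index)
open import Data.List.Relation.Unary.Any.Properties using (lookup-index)
open import Data.List.Relation.Unary.All as All using (All; []; _∷_)
import Data.List.Relation.Unary.All.Properties as All
open import Data.List.Relation.Unary.AllPairs using ([]; _∷_)
open import Data.List.Relation.Unary.Linked using (Linked; [-]; _∷_)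
open import Data.List.Relation.Unary.Unique.Propositional using (Unique)
import Data.List.Relation.Unary.Unique.Propositional.Properties as Unique
open import Data.List.Relation.Binary.Sublist.Propositional as Sublist
  using (_⊆_; []; _∷_; _∷ʳ_)
import Data.List.Relation.Binary.Sublist.Propositional.Properties as Sublist
open import Data.List.Relation.Binary.Permutation.Propositional
  using (_↭_; prep; ↭-refl; ↭-sym; ↭-trans; ↭⇒↭ₛ)
import Data.List.Relation.Binary.Permutation.Propositional.Properties as Perm
import Data.List.Relation.Binary.Permutation.Setoid.Properties as PermSetoid
import Algebra.Solver.CommutativeMonoid as CommutativeMonoidSolver
open import Data.Product using (∃; ∃₂; ∃-syntax; _×_; _,_; proj₁; proj₂)
open import Data.Sum using (_⊎_; inj₁; inj₂; map₂)
open import Data.Empty using (⊥; ⊥-elim)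
open import Relation.Nullary using (yes; no; ¬?; contradiction)
open import Relation.Nullary.Decidable using (decidable-stable)
open import Relation.Binary.PropositionalEquality
  using (_≡_; _≢_; refl; sym; trans; cong; cong₂; subst; subst₂; setoid; module ≡-Reasoning)
open import Function using (_∘_; id; case_of_)
open import Function.Definitions using (Injective)

-- Lists: uniqueness, sublists, pigeonhole

positive : ∀ {m} {i : Fin (suc m)} → 0 < toℕ i → ∃[ j ] i ≡ suc j
positive {i = suc j} _ = j , refl

module _ {X : Set} where

  Unique-resp-↭ : {xs ys : List X} → xs ↭ ys → Unique xs → Unique ys
  Unique-resp-↭ p = PermSetoid.Unique-resp-↭ (setoid X) (↭⇒↭ₛ p)

  Unique-⊆ : ∀ {xs ys : List X} → xs ⊆ ys → Unique ys → Unique xs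
  Unique-⊆ []           []      = []
  Unique-⊆ (y ∷ʳ p)     (_ ∷ u) = Unique-⊆ p u
  Unique-⊆ (refl ∷ p)   (q ∷ u) = Sublist.All-resp-⊆ p q ∷ Unique-⊆ p u

  Unique-++⁻ʳ : ∀ (xs : List X) {ys} → Unique (xs ++ ys) → Unique ys
  Unique-++⁻ʳ []       u       = u
  Unique-++⁻ʳ (x ∷ xs) (_ ∷ u) = Unique-++⁻ʳ xs u

  Unique-++-disjoint : ∀ (xs : List X) {ys v} → Unique (xs ++ ys) → v ∈ xs → v ∉ ys
  Unique-++-disjoint (x ∷ xs) (p ∷ u) (here refl) v∈ys = All.lookup p (∈-++⁺ʳ xs v∈ys) refl
  Unique-++-disjoint (x ∷ xs) (p ∷ u) (there v∈xs) v∈ys = Unique-++-disjoint xs u v∈xs v∈ys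

  ∉⇒All≢ : ∀ {x : X} {xs} → x ∉ xs → All (x ≢_) xs
  ∉⇒All≢ x∉xs = All.tabulate λ y∈xs x≡y → x∉xs (subst (_∈ _) (sym x≡y) y∈xs)

  lookup-injective : ∀ {xs : List X} → Unique xs → Injective _≡_ _≡_ (lookup xs)
  lookup-injective (p ∷ u) {zero}  {zero}  eq = refl
  lookup-injective (p ∷ u) {zero}  {suc j} eq = contradiction eq (All.lookup p (∈-lookup j))
  lookup-injective (p ∷ u) {suc i} {zero}  eq = contradiction (sym eq) (All.lookup p (∈-lookup i))
  lookup-injective (p ∷ u) {suc i} {suc j} eq = cong suc (lookup-injective u eq)

  Unique⇒length≤ : ∀ {xs ys : List X} → Unique xs → (∀ {v} → v ∈ xs → v ∈ ys) →
    length xs ≤ length ys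
  Unique⇒length≤ {xs} {ys} u xs⊆ys = injective⇒≤ {f = λ i → index (xs⊆ys (∈-lookup i))} λ {i} {j} eq →
    lookup-injective u (trans (lookup-index (xs⊆ys (∈-lookup i)))
      (trans (cong (lookup ys) eq) (sym (lookup-index (xs⊆ys (∈-lookup j))))))

  sublist-split : ∀ {x : X} {xs zs} → x ∷ xs ⊆ zs → ∃₂ λ as bs → zs ≡ as ++ x ∷ bs × xs ⊆ bs
  sublist-split (y ∷ʳ p) with as , bs , refl , q ← sublist-split p = y ∷ as , bs , refl , q
  sublist-split (refl ∷ p) = [] , _ , refl , p

  -- Turns the increasing positions in `KOrdered` into a sublist relation. The first entry of
  -- `tabulate f` is kept if `p zero` is `zero` and skipped otherwise; the positions that remain are
  -- then all positive and `q` lowers them by one.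
  tabulate-sublist : ∀ {m k} (f : Fin m → X) (p : Fin k → Fin m) →
    (∀ i j → toℕ i < toℕ j → toℕ (p i) < toℕ (p j)) → tabulate (f ∘ p) ⊆ tabulate f
  tabulate-sublist {m} {zero} f p mono = Sublist.minimum _
  tabulate-sublist {zero} {suc k} f p mono with () ← p zero
  tabulate-sublist {suc m} {suc k} f p mono with p zero in p0
  ... | zero = refl ∷ subst (_⊆ _) (sym (tabulate-cong (λ i → cong f (proj₂ (q i)))))
          (tabulate-sublist (f ∘ suc) (proj₁ ∘ q) q-mono)
    where
    q : ∀ i → ∃[ j ] p (suc i) ≡ suc j
    q i = positive (subst (_< toℕ (p (suc i))) (cong toℕ p0) (mono zero (suc i) z<s))
    q-mono : ∀ i j → toℕ i < toℕ j → toℕ (proj₁ (q i)) < toℕ (proj₁ (q j))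
    q-mono i j i<j = s<s⁻¹ (subst₂ _<_ (cong toℕ (proj₂ (q i))) (cong toℕ (proj₂ (q j)))
      (mono (suc i) (suc j) (s≤s i<j)))
  ... | suc h = _ ∷ʳ subst (_⊆ tabulate (f ∘ suc))
          (cong (f (suc h) ∷_) (sym (tabulate-cong (λ i → cong f (proj₂ (q (suc i)))))))
          (tabulate-sublist (f ∘ suc) (proj₁ ∘ q) q-mono)
    where
    q : ∀ i → ∃[ j ] p i ≡ suc j
    q zero    = h , p0
    q (suc i) = positive (≤-<-trans z≤n (mono zero (suc i) z<s))
    q-mono : ∀ i j → toℕ i < toℕ j → toℕ (proj₁ (q i)) < toℕ (proj₁ (q j))
    q-mono i j i<j = s<s⁻¹ (subst₂ _<_ (cong toℕ (proj₂ (q i))) (cong toℕ (proj₂ (q j)))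
      (mono i j i<j))

-- Extending sequences of distinct vertices

module _ {n : ℕ} where

  open import Data.List.Membership.DecPropositional (_≟_ {n}) using (_∈?_) public

  fresh : ∀ (xs : List (Fin n)) → length xs < n → ∃[ v ] v ∉ xs
  fresh xs |xs|<n with any? (λ v → ¬? (v ∈? xs))
  ... | yes v∉xs = v∉xs
  ... | no ¬fresh = contradiction
          (subst (_≤ length xs) (length-tabulate id) (Unique⇒length≤ (Unique.allFin⁺ n) all∈))
          (<⇒≱ |xs|<n)
    where
    all∈ : ∀ {v} → v ∈ allFin n → v ∈ xs
    all∈ {v} _ = decidable-stable (v ∈? xs) (λ v∉ → ¬fresh (v , v∉))

  extend : ∀ d (xs : List (Fin n)) → Unique xs → length xs + d ≤ n →
    ∃[ ys ] Unique (xs ++ ys) × length (xs ++ ys) ≡ length xs + d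
  extend zero xs u _ =
    [] , subst Unique (sym (++-identityʳ xs)) u
    , trans (cong length (++-identityʳ xs)) (sym (+-identityʳ _))
  extend (suc d) xs u le
    with v , v∉xs ← fresh xs (≤-trans (m<m+n (length xs) z<s) le)
    with ys , u' , eq ← extend d (v ∷ xs) (∉⇒All≢ v∉xs ∷ u) (subst (_≤ n) (+-suc _ d) le)
    = v ∷ ys , Unique-resp-↭ (↭-sym (Perm.shift v xs ys)) u'
    , trans (Perm.↭-length (Perm.shift v xs ys)) (trans eq (sym (+-suc _ d)))

-- Walks, closed walks and cycles

module Walks {n : ℕ} (G : SimpleGraph n) where

  infixr 5 _∷_ _⁀_

  -- The index lists interior vertices only, so that `c ⇝[ cs ] c` passes through exactly `c ∷ cs`,
  -- with no repeated endpoint.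
  data _⇝[_]_ : Fin n → List (Fin n) → Fin n → Set where
    edge : ∀ {u w} → Adj G u w → u ⇝[ [] ] w
    _∷_  : ∀ {u x xs w} → Adj G u x → x ⇝[ xs ] w → u ⇝[ x ∷ xs ] w

  _⁀_ : ∀ {u v w xs ys} → u ⇝[ xs ] v → v ⇝[ ys ] w → u ⇝[ xs ++ v ∷ ys ] w
  edge e  ⁀ q = e ∷ q
  (e ∷ p) ⁀ q = e ∷ (p ⁀ q)

  split : ∀ xs {ys u v w} → u ⇝[ xs ++ v ∷ ys ] w → u ⇝[ xs ] v × v ⇝[ ys ] w
  split []       (e ∷ p) = edge e , p
  split (x ∷ xs) (e ∷ p) with q , r ← split xs p = e ∷ q , r

  reverseW : ∀ {u xs w} → u ⇝[ xs ] w → w ⇝[ reverse xs ] u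
  reverseW (edge e) = edge (symm G e)
  reverseW {u} {x ∷ xs} {w} (e ∷ p) =
    subst (w ⇝[_] u) (sym (unfold-reverse x xs)) (reverseW p ⁀ edge (symm G e))

  -- If the first interior vertex recurs, the segment up to its recurrence is cut out but the vertex
  -- itself stays. Hence a nonempty interior remains nonempty, which is what makes a detour lengthen
  -- a cycle.
  simplify : ∀ {u xs w} → u ⇝[ xs ] w →
    ∃[ ys ] u ⇝[ ys ] w × Unique ys × (∀ {v} → v ∈ ys → v ∈ xs) × (0 < length xs → 0 < length ys)
  simplify (edge e) = [] , edge e , [] , id , id
  simplify {xs = x ∷ xs} (e ∷ p) with ys , q , u , ys⊆xs , _ ← simplify p with x ∈? ys
  ... | no x∉ys = x ∷ ys , e ∷ q , ∉⇒All≢ x∉ys ∷ u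
                , (λ { (here eq) → here eq ; (there v∈) → there (ys⊆xs v∈) }) , λ _ → z<s
  ... | yes x∈ys with as , bs , refl ← ∈-∃++ x∈ys =
          x ∷ bs , e ∷ proj₂ (split as q) , Unique-++⁻ʳ as u
        , (λ v∈ → there (ys⊆xs (∈-++⁺ʳ as v∈))) , λ _ → z<s

  Closed : List (Fin n) → Set
  Closed []       = ⊥
  Closed (c ∷ cs) = c ⇝[ cs ] c

  rotate : ∀ xs {ys} → Closed (xs ++ ys) → Closed (ys ++ xs)
  rotate []       {ys} p = subst Closed (sym (++-identityʳ ys)) p
  rotate (x ∷ xs) {[]} p = subst Closed (++-identityʳ (x ∷ xs)) p
  rotate (x ∷ xs) {y ∷ ys} p with q , r ← split xs p = r ⁀ q

  reverse-closed : ∀ xs → Closed xs → Closed (reverse xs)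
  reverse-closed (x ∷ xs) p = subst Closed (sym (unfold-reverse x xs)) (rotate [ x ] (reverseW p))

  lookup-adj : ∀ {u xs w} → u ⇝[ xs ] w → ∀ i j → suc (toℕ i) ≡ toℕ j →
    Adj G (lookup (u ∷ xs) i) (lookup (u ∷ xs) j)
  lookup-adj (e ∷ p) zero    (suc zero) _  = e
  lookup-adj (e ∷ p) (suc i) (suc j)    eq = lookup-adj p i j (cong pred eq)
  lookup-adj (edge e) zero   (suc ())   _

  lookup-last-adj : ∀ {u xs w} → u ⇝[ xs ] w → ∀ i → toℕ i ≡ length xs →
    Adj G (lookup (u ∷ xs) i) w
  lookup-last-adj (edge e) zero    _  = e
  lookup-last-adj (e ∷ p)  (suc i) eq = lookup-last-adj p i (cong pred eq)

  tabulate-walk : ∀ m (f : Fin (suc m) → Fin n) {w} →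
    (∀ i → Adj G (f (inject₁ i)) (f (suc i))) → Adj G (f (fromℕ m)) w →
    f zero ⇝[ tabulate (f ∘ suc) ] w
  tabulate-walk zero    f _  e = edge e
  tabulate-walk (suc m) f es e = es zero ∷ tabulate-walk m (f ∘ suc) (es ∘ suc) e

  list→cycle : ∀ {xs} → Closed xs → Unique xs → 3 ≤ length xs → Cycle G (length xs)
  list→cycle {x ∷ xs} p u 3≤ = record
    { len≥3 = 3≤
    ; vert  = lookup (x ∷ xs)
    ; inj   = lookup-injective u
    ; step  = lookup-adj p
    ; close = λ { i zero eq _ → lookup-last-adj p i (cong pred eq) }
    }

  cycle→closed : ∀ {m} (C : Cycle G m) → Closed (tabulate (vert C))
  cycle→closed {zero} C with () ← len≥3 C
  cycle→closed {suc m} C = tabulate-walk m (vert C)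
    (λ i → step C (inject₁ i) (suc i) (cong suc (toℕ-inject₁ i)))
    (close C (fromℕ m) zero (cong suc (toℕ-fromℕ m)) refl)

  cycle→unique : ∀ {m} (C : Cycle G m) → Unique (tabulate (vert C))
  cycle→unique C = Unique.tabulate⁺ (inj C)

  ordered-cycle : ∀ x vs → KOrdered G (length (x ∷ vs)) → Unique (x ∷ vs) →
    ∃[ zs ] x ⇝[ zs ] x × Unique (x ∷ zs) × vs ⊆ zs
  ordered-cycle x vs ko u
    with m , C , p , on , mono ← ko (lookup (x ∷ vs)) (lookup-injective u)
    with as , bs , eq , vs⊆bs ← sublist-split
           (subst (_⊆ tabulate (vert C)) (trans (tabulate-cong on) (tabulate-lookup (x ∷ vs)))
             (tabulate-sublist (vert C) p mono))
    -- The cycle is rotated to start at `x`: the part `as` before `x` moves to the end.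
    = bs ++ as
    , rotate as (subst Closed eq (cycle→closed C))
    , Unique-resp-↭ (Perm.++-comm as (x ∷ bs)) (subst Unique eq (cycle→unique C))
    , Sublist.++⁺ʳ as vs⊆bs

-- Lengthening a cycle by a component outside it

-- Negations are written P → A, where A is the statement being proved. This allows classical
-- reasoning although adjacency is not decidable.
module Improve {n : ℕ} (G : SimpleGraph n) (A : Set) (C₀ : List (Fin n)) (C₀-unique : Unique C₀)
  (longer : ∀ {L} → Walks.Closed G L → Unique L → length C₀ < length L → A)
  (x : Fin n) (x∉C₀ : x ∉ C₀) where

  open Walks G
  open CommutativeMonoidSolver (Perm.++-commutativeMonoid {A = Fin n}) using (solve; _⊕_; _⊜_)

  -- Only the start `u` is allowed to lie on `C₀`. Thus `Conn u w` means a walk from `u` to `w` with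
  -- no interior vertex on `C₀`, except possibly none at all; it is used for `u = x` and for gap
  -- vertices `u`.
  data Reach (u : Fin n) : Fin n → Set where
    here : Reach u u
    snoc : ∀ {y z} → Reach u y → Adj G y z → z ∉ C₀ → Reach u z

  Conn : Fin n → Fin n → Set
  Conn u w = ∃[ y ] Reach u y × Adj G y w

  -- The neighbours of the component of x in G minus C₀.
  N : Fin n → Set
  N = Conn x

  Reach-off : ∀ {y} → Reach x y → y ∉ C₀
  Reach-off here         = x∉C₀
  Reach-off (snoc _ _ z) = z

  conn-walk : ∀ {u w} → Conn u w → ∃[ qs ] u ⇝[ qs ] w × All (λ q → q ∉ C₀ × Reach u q) qs
  conn-walk {u} {w} (y , r , e) = go r (edge e) []
    where
    go : ∀ {y ys} → Reach u y → y ⇝[ ys ] w → All (λ q → q ∉ C₀ × Reach u q) ys →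
      ∃[ qs ] u ⇝[ qs ] w × All (λ q → q ∉ C₀ × Reach u q) qs
    go here p a = _ , p , a
    go (snoc r e z∉) p a = go r (e ∷ p) ((z∉ , snoc r e z∉) ∷ a)

  -- The walks from `x` to `s` and to `t` are joined at `x`, so the interior is nonempty before
  -- simplification and hence after it.
  detour : ∀ {s t} → N s → N t →
    ∃[ hs ] s ⇝[ hs ] t × Unique hs × 0 < length hs × All (λ h → h ∉ C₀ × Reach x h) hs
  detour ns nt
    with ps , p , a ← conn-walk ns
    with qs , q , b ← conn-walk nt
    with hs , h , u , hs⊆ , pos ← simplify (reverseW p ⁀ q)
    = hs , h , u , pos (∈-length (∈-insert (reverse ps)))
    , All.tabulate λ v∈ → All.lookup
        (All.++⁺ (Perm.All-resp-↭ (↭-sym (Perm.↭-reverse ps)) a) ((x∉C₀ , here) ∷ b)) (hs⊆ v∈)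

  -- All cycles on the vertex set of C₀, in particular its rotations and its reversal.
  Rot : List (Fin n) → Set
  Rot L = Closed L × L ↭ C₀

  Rot-rotate : ∀ xs {ys} → Rot (xs ++ ys) → Rot (ys ++ xs)
  Rot-rotate xs {ys} (p , q) = rotate xs p , ↭-trans (Perm.++-comm ys xs) q

  Rot-unique : ∀ {L} → Rot L → Unique L
  Rot-unique (_ , q) = Unique-resp-↭ (↭-sym q) C₀-unique

  Rot-∈ : ∀ {L v} → Rot L → v ∈ L → v ∈ C₀
  Rot-∈ (_ , q) = Perm.∈-resp-↭ q

  lengthen : ∀ {L es L'} → Rot L → Unique es → 0 < length es → All (_∉ C₀) es →
    Closed L' → L' ↭ L ++ es → A
  lengthen {L} {es} {L'} rot ues pos off p q = longer p
    (Unique-resp-↭ (↭-sym q) (Unique.++⁺ (Rot-unique rot) ues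
      λ (v∈L , v∈es) → All.lookup off v∈es (Rot-∈ rot v∈L)))
    (begin-strict
      length C₀             ≡⟨ Perm.↭-length (proj₂ rot) ⟨
      length L              <⟨ m<m+n (length L) pos ⟩
      length L + length es  ≡⟨ length-++ L ⟨
      length (L ++ es)      ≡⟨ Perm.↭-length q ⟨
      length L'             ∎)
    where open ≤-Reasoning

  -- The edge from `a` to `b` is replaced by a detour.
  no-consecutive : ∀ {a b Y} → Rot (a ∷ b ∷ Y) → N a → N b → A
  no-consecutive {a} {b} {Y} rot@(e ∷ p , _) na nb
    with hs , h , u , pos , props ← detour na nb
    = lengthen rot u pos (All.map proj₁ props) (h ⁀ p)
        (prep a (Perm.++-comm hs (b ∷ Y)))

  -- The walk, followed backwards from `q` to `a`, stays off `C₀` until it arrives at `a`.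
  attach : ∀ {a b q qs} → a ⇝[ qs ] b → All (_∉ C₀) qs → Reach x q → q ∈ qs → N a
  attach {q = q} (e ∷ _) _ r (here refl) = q , r , symm G e
  attach (e ∷ p) (off ∷ offs) r (there q∈)
    with y , r' , e' ← attach p offs r q∈ = _ , snoc r' e' off , symm G e

  -- The longer cycle runs from `s` by the detour `hs` to `t`, backwards through `P` to `a`, by `qs`
  -- to `b`, and on through `Q`. If `hs` and `qs` meet, then `attach` makes `a` a neighbour of the
  -- component of `x`.
  crossing : ∀ {s a t b} P {Q} → Rot (s ∷ a ∷ P ++ t ∷ b ∷ Q) →
    N s → N t → (N a → A) → Conn a b → A
  crossing {s} {a} {t} {b} P {Q} rot@(e ∷ p , _) ns nt ¬na conn
    with hs , h , u , pos , props ← detour ns nt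
    with qs' , q' , props' ← conn-walk conn
    with qs , q , u' , qs⊆ , _ ← simplify q'
    with Any.any? (_∈? qs) hs
  ... | yes meet = ¬na (let h , h∈hs , h∈qs = find meet in
          attach q off (proj₂ (All.lookup props h∈hs)) h∈qs)
    where
    off : All (_∉ C₀) qs
    off = All.tabulate λ v∈ → proj₁ (All.lookup props' (qs⊆ v∈))
  ... | no disjoint
    with p₁ , _ ∷ p₂ ← split P p
    = lengthen rot
        (Unique.++⁺ u u' λ (v∈hs , v∈qs) → disjoint (lose v∈hs v∈qs))
        (≤-trans pos (≤-trans (m≤m+n _ _) (≤-reflexive (sym (length-++ hs)))))
        (All.++⁺ (All.map proj₁ props) off)
        (h ⁀ reverseW p₁ ⁀ q ⁀ p₂)
        (↭-trans
          (solve 8 (λ s a R t b Q hs qs →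
            (s ⊕ hs ⊕ t ⊕ R ⊕ a ⊕ qs ⊕ b ⊕ Q) ⊜ ((s ⊕ a ⊕ R ⊕ t ⊕ b ⊕ Q) ⊕ (hs ⊕ qs)))
            ↭-refl [ s ] [ a ] (reverse P) [ t ] [ b ] Q hs qs)
          (Perm.++⁺ʳ (hs ++ qs) (prep s (prep a (Perm.++⁺ʳ (t ∷ b ∷ Q) (Perm.↭-reverse P))))))
    where
    off : All (_∉ C₀) qs
    off = All.tabulate λ v∈ → proj₁ (All.lookup props' (qs⊆ v∈))

  -- Reversing the cycle makes `s` and `t` the predecessors of `a` and `b`; a rotation then gives
  -- the shape that `crossing` expects, with `reverse Q` and `reverse P` as its segments.
  mirrored-crossing : ∀ {a s b t} P {Q} → Rot (a ∷ s ∷ P ++ b ∷ t ∷ Q) →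
    N s → N t → (N a → A) → Conn a b → A
  mirrored-crossing {a} {s} {b} {t} P {Q} (p , q) ns nt =
    crossing (reverse Q) (subst Rot eq₂ (Rot-rotate (reverse P)
      (subst Rot eq₁ (Rot-rotate (reverse Q ++ t ∷ b ∷ []) (subst Rot eq₀ reversed))))) ns nt
    where
    reversed : Rot (reverse (a ∷ s ∷ P ++ b ∷ t ∷ Q))
    reversed = reverse-closed (a ∷ s ∷ P ++ b ∷ t ∷ Q) p , ↭-trans (Perm.↭-reverse _) q
    eq₀ : reverse (a ∷ s ∷ P ++ b ∷ t ∷ Q)
      ≡ (reverse Q ++ t ∷ b ∷ []) ++ (reverse P ++ s ∷ a ∷ [])
    eq₀ = trans (reverse-++ (a ∷ s ∷ P) (b ∷ t ∷ Q))
      (cong₂ _++_ (reverse-++ (b ∷ t ∷ []) Q) (reverse-++ (a ∷ s ∷ []) P))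
    eq₁ : (reverse P ++ s ∷ a ∷ []) ++ (reverse Q ++ t ∷ b ∷ [])
      ≡ reverse P ++ s ∷ a ∷ reverse Q ++ t ∷ b ∷ []
    eq₁ = ++-assoc (reverse P) (s ∷ a ∷ []) _
    eq₂ : (s ∷ a ∷ reverse Q ++ t ∷ b ∷ []) ++ reverse P ≡ s ∷ a ∷ reverse Q ++ t ∷ b ∷ reverse P
    eq₂ = cong (λ L → s ∷ a ∷ L) (++-assoc (reverse Q) (t ∷ b ∷ []) (reverse P))

  -- Separation by the attachments

  Iso : Fin n → Set
  Iso u = ∀ {w} → w ∈ C₀ → (N w → A) → w ≢ u → Conn u w → A

  Iso-x : Iso x
  Iso-x _ ¬nw _ nw = ¬nw nw

  module Separator (S : List (Fin n)) (S-complete : ∀ {w} → w ∈ C₀ → w ∉ S → N w → A) where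

    Sep : Fin n → Fin n → Set
    Sep u w = ∀ {ys} → u ⇝[ ys ] w → A ⊎ Any (_∈ S) ys

    Sep-sym : ∀ {u w} → Sep u w → Sep w u
    Sep-sym sep {ys} p = map₂ (Perm.Any-resp-↭ (Perm.↭-reverse ys)) (sep (reverseW p))

    -- Consider the first vertex of the walk that lies in `S`, or on `C₀` and differs from `u`. If
    -- it is not in `S`, it contradicts `Iso u`. A return to `u` just restarts the argument.
    Iso⇒Sep : ∀ {u w} → Iso u → w ∈ C₀ → (N w → A) → w ≢ u → Sep u w
    Iso⇒Sep {u} {w} iso w∈ ¬nw w≢u = go here
      where
      go : ∀ {y ys} → Reach u y → y ⇝[ ys ] w → A ⊎ Any (_∈ S) ys
      go r (edge e) = inj₁ (iso w∈ ¬nw w≢u (_ , r , e))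
      go r (_∷_ {x = z} e p) with z ∈? S | z ∈? C₀ | z ≟ u
      ... | yes z∈S | _      | _        = inj₂ (here z∈S)
      ... | no _    | no z∉  | _        = map₂ there (go (snoc r e z∉) p)
      ... | no _    | yes _  | yes refl = map₂ there (go here p)
      ... | no z∉S  | yes z∈ | no z≢u   = inj₁ (iso z∈ (S-complete z∈ z∉S) z≢u (_ , r , e))

    -- The `vs` cut the walk into one arc more than their number, and each arc has an interior
    -- vertex in `S`.
    count : ∀ {u zs w} vs → u ⇝[ zs ] w → vs ⊆ zs → Linked Sep (u ∷ vs ++ [ w ]) →
      A ⊎ length vs < length (filter (_∈? S) zs)
    count [] p _ (sep ∷ _) = map₂ (filter-some (_∈? S)) (sep p)
    count (v ∷ vs) p vs⊆ (sep ∷ seps)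
      with as , bs , refl , vs⊆bs ← sublist-split vs⊆
      with q , r ← split as p
      with sep q | count vs r vs⊆bs seps
    ... | inj₁ a | _ = inj₁ a
    ... | inj₂ _ | inj₁ a = inj₁ a
    ... | inj₂ hit | inj₂ lt = inj₂ (begin
            2 + length vs ≤⟨ +-mono-≤ (filter-some (_∈? S) hit) lt ⟩
            length (filter (_∈? S) as) + length (filter (_∈? S) bs)
              ≤⟨ +-monoʳ-≤ (length (filter (_∈? S) as))
                   (≤-trans (m≤n+m _ (length (filter (_∈? S) [ v ])))
                     (≤-reflexive (trans (sym (length-++ (filter (_∈? S) [ v ])))
                        (cong length (sym (filter-++ (_∈? S) [ v ] bs)))))) ⟩
            length (filter (_∈? S) as) + length (filter (_∈? S) (v ∷ bs))
              ≡⟨ length-++ (filter (_∈? S) as) ⟨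
            length (filter (_∈? S) as ++ filter (_∈? S) (v ∷ bs))
              ≡⟨ cong length (filter-++ (_∈? S) as (v ∷ bs)) ⟨
            length (filter (_∈? S) (as ++ v ∷ bs)) ∎)
      where open ≤-Reasoning

    -- The arc from `x` to `b` has an interior vertex in `S`, but all of `S` comes after `b` on the
    -- cycle, and no vertex occurs twice.
    no-early-return : ∀ {b vs zs} → x ⇝[ zs ] x → Unique zs → b ∷ vs ⊆ zs →
      (∀ {v} → v ∈ S → v ∈ vs) → b ∈ C₀ → (N b → A) → A
    no-early-return p u vs⊆ S⊆vs b∈ ¬nb
      with as , bs , refl , rest⊆ ← sublist-split vs⊆
      with Iso⇒Sep Iso-x b∈ ¬nb (λ { refl → x∉C₀ b∈ }) (proj₁ (split as p))
    ... | inj₁ a = a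
    ... | inj₂ hit = let v , v∈as , v∈S = find hit in
            contradiction (there (Sublist.lookup rest⊆ (S⊆vs v∈S))) (Unique-++-disjoint as u v∈as)

    few-attachments : ∀ {k b} → KOrdered G k → k ≤ n → 2 + length S ≤ k → Unique S →
      (∀ {v} → v ∈ S → v ∈ C₀) → All N S → b ∈ C₀ → (N b → A) → A
    few-attachments {k} {b} ko k≤n |S|≤k uS S⊆C₀ nS b∈ ¬nb with b ∈? S
    ... | yes b∈S = ¬nb (All.lookup nS b∈S)
    ... | no b∉S =
            -- The sequence `x`, `b`, `S` is padded to length `k` by arbitrary further vertices,
            -- placed after `S` so that they do not interfere.
            let ys , u , len = extend (k ∸ (2 + length S)) (x ∷ b ∷ S)
                  (∉⇒All≢ x∉b∷S ∷ ∉⇒All≢ b∉S ∷ uS) (subst (_≤ n) (sym k≡) k≤n)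
                zs , p , uz , vs⊆ = ordered-cycle x (b ∷ S ++ ys)
                  (subst (KOrdered G) (sym (trans len k≡)) ko) u
            in no-early-return p (Unique-++⁻ʳ [ x ] uz) vs⊆ ∈-++⁺ˡ b∈ ¬nb
      where
      k≡ : 2 + length S + (k ∸ (2 + length S)) ≡ k
      k≡ = m+[n∸m]≡n |S|≤k
      x∉b∷S : x ∉ b ∷ S
      x∉b∷S (here refl) = x∉C₀ b∈
      x∉b∷S (there x∈S) = x∉C₀ (S⊆C₀ x∈S)

    -- Each pair is separated because its later member is isolated. The first vertex `u` therefore
    -- needs no `Iso`, and may come from the one gap with two vertices.
    Sep-chain : ∀ {u} hs → u ∈ C₀ → (N u → A) → Unique (u ∷ hs) → All Iso hs →
      All (λ h → h ∈ C₀ × (N h → A)) hs → Linked Sep (u ∷ hs ++ [ x ])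
    Sep-chain [] u∈ ¬nu _ _ _ =
      Sep-sym (Iso⇒Sep Iso-x u∈ ¬nu (λ { refl → x∉C₀ u∈ })) ∷ [-]
    Sep-chain (h ∷ hs) u∈ ¬nu ((u≢h ∷ _) ∷ uq) (iso ∷ isos) ((h∈ , ¬nh) ∷ props) =
      Sep-sym (Iso⇒Sep iso u∈ ¬nu u≢h) ∷ Sep-chain hs h∈ ¬nh uq isos props

    -- A cycle through `x`, `g` and `hs` in this order has `2 + length hs` arcs, each needing its
    -- own vertex of `S`.
    many-attachments : ∀ {g} hs → KOrdered G (2 + length hs) → length S ≤ suc (length hs) →
      Unique (g ∷ hs) → All Iso hs → All (λ h → h ∈ C₀ × (N h → A)) (g ∷ hs) → A
    many-attachments {g} hs ko |S|≤ u isos props@((g∈ , ¬ng) ∷ props')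
      with zs , p , _ ∷ uz , vs⊆ ← ordered-cycle x (g ∷ hs) ko
             (All.map (λ { (h∈ , _) refl → x∉C₀ h∈ }) props ∷ u)
      with count (g ∷ hs) p vs⊆
             (Iso⇒Sep Iso-x g∈ ¬ng (λ { refl → x∉C₀ g∈ }) ∷ Sep-chain hs g∈ ¬ng u isos props')
    ... | inj₁ a = a
    ... | inj₂ lt = contradiction
            (≤-trans (Unique⇒length≤ (Unique.filter⁺ (_∈? S) uz)
              (λ v∈ → proj₂ (∈-filter⁻ (_∈? S) {xs = zs} v∈))) |S|≤)
            (<⇒≱ lt)

  -- Cutting the cycle into blocks

  NotBoth : Fin n → Fin n → Set
  NotBoth a b = N a → N b → A

  DecN : Fin n → Set
  DecN c = N c ⊎ (N c → A)

  linked : ∀ Y {a s₀ X} → Rot (a ∷ Y ++ s₀ ∷ X) → Linked NotBoth (a ∷ Y ++ [ s₀ ])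
  linked []      rot = no-consecutive rot ∷ [-]
  linked (b ∷ Y) {a} {s₀} {X} rot = no-consecutive rot
    ∷ linked Y (subst Rot (++-assoc (b ∷ Y) (s₀ ∷ X) [ a ]) (Rot-rotate [ a ] rot))

  -- The gap is `first ∷ others`, so it is nonempty by construction.
  record Block : Set where
    constructor block
    field
      attachment : Fin n
      first      : Fin n
      others     : List (Fin n)
  open Block

  flatten : List Block → List (Fin n)
  flatten []                   = []
  flatten (block s g gs ∷ B) = s ∷ g ∷ gs ++ flatten B

  flatten-++ : ∀ B {B'} → flatten (B ++ B') ≡ flatten B ++ flatten B'
  flatten-++ []                       = refl
  flatten-++ (block s g gs ∷ B) {B'} = cong (λ L → s ∷ g ∷ L)
    (trans (cong (gs ++_) (flatten-++ B)) (sym (++-assoc gs (flatten B) (flatten B'))))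

  Good : Block → Set
  Good (block s g gs) = N s × (N g → A) × All (λ z → N z → A) gs

  mutual
    -- Here `s₀` is the attached vertex that follows the list on the cycle; it rules out an empty
    -- gap at the very end.
    parse : ∀ {s₀} s cs → N s → N s₀ → Linked NotBoth (s ∷ cs ++ [ s₀ ]) →
      All DecN cs → A ⊎ ∃₂ λ b B → flatten (b ∷ B) ≡ s ∷ cs × All Good (b ∷ B)
    parse s []       ns ns₀ (bad ∷ _) _                = inj₁ (bad ns ns₀)
    parse s (g ∷ cs) ns ns₀ (bad ∷ _) (inj₁ ng ∷ _)   = inj₁ (bad ns ng)
    parse s (g ∷ cs) ns ns₀ (_ ∷ l)   (inj₂ ¬ng ∷ ds) with parse-gap cs ns₀ l ds
    ... | inj₁ a = inj₁ a
    ... | inj₂ (gs , B , eq , ¬gs , good) =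
            inj₂ (block s g gs , B , cong (λ L → s ∷ g ∷ L) eq , (ns , ¬ng , ¬gs) ∷ good)

    parse-gap : ∀ {s₀ c} cs → N s₀ → Linked NotBoth (c ∷ cs ++ [ s₀ ]) →
      All DecN cs →
      A ⊎ ∃₂ λ gs B → gs ++ flatten B ≡ cs × All (λ z → N z → A) gs × All Good B
    parse-gap []       ns₀ _       _              = inj₂ ([] , [] , refl , [] , [])
    parse-gap (c ∷ cs) ns₀ (_ ∷ l) (inj₁ nc ∷ ds) with parse c cs nc ns₀ l ds
    ... | inj₁ a = inj₁ a
    ... | inj₂ (b , B , eq , good) = inj₂ ([] , b ∷ B , eq , [] , good)
    parse-gap (c ∷ cs) ns₀ (_ ∷ l) (inj₂ ¬nc ∷ ds) with parse-gap cs ns₀ l ds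
    ... | inj₁ a = inj₁ a
    ... | inj₂ (gs , B , eq , ¬gs , good) = inj₂ (c ∷ gs , B , cong (c ∷_) eq , ¬nc ∷ ¬gs , good)

  attachments-⊆ : ∀ B → map attachment B ⊆ flatten B
  attachments-⊆ []                 = []
  attachments-⊆ (block s g gs ∷ B) = refl ∷ g ∷ʳ Sublist.++⁺ˡ gs (attachments-⊆ B)

  firsts-⊆ : ∀ B → map first B ⊆ flatten B
  firsts-⊆ []                 = []
  firsts-⊆ (block s g gs ∷ B) = s ∷ʳ refl ∷ Sublist.++⁺ˡ gs (firsts-⊆ B)

  ∈-flatten : ∀ B {w} → w ∈ flatten B → ∃₂ λ B₁ b → ∃ λ B₂ → B ≡ B₁ ++ b ∷ B₂ ×
    (w ≡ attachment b ⊎ w ≡ first b ⊎ w ∈ others b)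
  ∈-flatten (b ∷ B) (here eq)         = [] , b , B , refl , inj₁ eq
  ∈-flatten (b ∷ B) (there (here eq)) = [] , b , B , refl , inj₂ (inj₁ eq)
  ∈-flatten (b ∷ B) (there (there w∈)) with ∈-++⁻ (others b) w∈
  ... | inj₁ w∈gs = [] , b , B , refl , inj₂ (inj₂ w∈gs)
  ... | inj₂ w∈B with B₁ , b' , B₂ , refl , pos ← ∈-flatten B w∈B = b ∷ B₁ , b' , B₂ , refl , pos

  length-flatten-≥ : ∀ B → length B + length B ≤ length (flatten B)
  length-flatten-≥ [] = z≤n
  length-flatten-≥ (block s g gs ∷ B) = s≤s (≤-trans (≤-reflexive (+-suc _ _)) (s≤s
    (≤-trans (length-flatten-≥ B) (≤-trans (m≤n+m _ (length gs)) (≤-reflexive (sym (length-++ gs)))))))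

  Single : Block → Set
  Single b = others b ≡ []

  -- The bound two counts `first` as well, hence the 1.
  AtMostTwo : Block → Set
  AtMostTwo b = length (others b) ≤ 1

  all-single : ∀ B → length (flatten B) ≤ length B + length B → All Single B
  all-single [] _ = []
  all-single (block s g [] ∷ B) le =
    refl ∷ all-single B (s≤s⁻¹ (s≤s⁻¹ (≤-trans le (≤-reflexive (cong suc (+-suc _ _))))))
  all-single (block s g (z ∷ gs) ∷ B) le = contradiction
    (≤-trans (s≤s⁻¹ (s≤s⁻¹ (≤-trans le (≤-reflexive (cong suc (+-suc _ _)))))) (length-flatten-≥ B))
    (<⇒≱ (s≤s (≤-trans (m≤n+m _ (length gs)) (≤-reflexive (sym (length-++ gs))))))

  -- Every block has at least two vertices, so only one vertex is left over for lengthening a gap.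
  one-long : ∀ b B → length (flatten (b ∷ B)) ≤ suc (length (b ∷ B) + length (b ∷ B)) →
    ∃₂ λ B₁ b' → ∃ λ B₂ → b ∷ B ≡ B₁ ++ b' ∷ B₂ × All Single B₁ × All Single B₂ × AtMostTwo b'
  -- If no gap is long, the last block plays the exceptional one.
  one-long (block s g []) [] _ = [] , _ , [] , refl , [] , [] , z≤n
  one-long (block s g []) (b ∷ B) le
    with B₁ , b' , B₂ , eq , s₁ , s₂ , two ← one-long b B
           (s≤s⁻¹ (s≤s⁻¹ (≤-trans le (≤-reflexive (cong (2 +_) (+-suc (length (b ∷ B)) (length (b ∷ B))))))))
    = block s g [] ∷ B₁ , b' , B₂ , cong (block s g [] ∷_) eq , refl ∷ s₁ , s₂ , two
  one-long (block s g (z ∷ gs)) B le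
    with le' ← subst (_≤ length B + length B) (length-++ gs) (s≤s⁻¹ (s≤s⁻¹ (s≤s⁻¹
           (≤-trans le (≤-reflexive (cong (2 +_) (+-suc _ _)))))))
    = [] , _ , B , refl , [] , all-single B (≤-trans (m≤n+m _ (length gs)) le')
    , s≤s (+-cancelʳ-≤ (length (flatten B)) (length gs) 0 (≤-trans le' (length-flatten-≥ B)))

  -- Distinct gaps are not connected off the cycle

  starts-attached : ∀ {s Y} M → All Good M → N s →
    ∃₂ λ s' Y' → N s' × flatten M ++ s ∷ Y ≡ s' ∷ Y'
  starts-attached []                 _                ns = _ , _ , ns , refl
  starts-attached (block s g gs ∷ M) ((ns , _) ∷ _) _  = _ , _ , ns , refl

  RotB : List Block → Set
  RotB B = Rot (flatten B)

  RotB-rotate : ∀ B {B'} → RotB (B ++ B') → RotB (B' ++ B)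
  RotB-rotate B {B'} rot =
    subst Rot (sym (flatten-++ B')) (Rot-rotate (flatten B) (subst Rot (flatten-++ B) rot))

  -- The predecessor `g` of `z` is a gap vertex, so `crossing` does not apply; but the successors of
  -- `h` and of `z` both start a block and are attached.
  mirrored-block-crossing : ∀ {t h s g z} M₁ {M₂} →
    RotB (block t h [] ∷ M₁ ++ block s g [ z ] ∷ M₂) → All Good M₁ → All Good M₂ →
    N t → N s → (N h → A) → Conn h z → A
  mirrored-block-crossing {t} {h} {s} {g} {z} M₁ {M₂} rot good₁ good₂ nt ns
    with s' , P , ns' , eq₁ ← starts-attached {Y = [ g ]} M₁ good₁ ns
       | t' , Q , nt' , eq₂ ← starts-attached {Y = []} M₂ good₂ nt
    = mirrored-crossing P (subst Rot (cong (h ∷_) eq) (Rot-rotate [ t ] rot)) ns' nt'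
    where
    open ≡-Reasoning
    eq : flatten (M₁ ++ block s g [ z ] ∷ M₂) ++ [ t ] ≡ s' ∷ P ++ z ∷ t' ∷ Q
    eq = begin
      flatten (M₁ ++ block s g [ z ] ∷ M₂) ++ [ t ]       ≡⟨ cong (_++ [ t ]) (flatten-++ M₁) ⟩
      (flatten M₁ ++ s ∷ g ∷ z ∷ flatten M₂) ++ [ t ]     ≡⟨ ++-assoc (flatten M₁) _ _ ⟩
      flatten M₁ ++ s ∷ g ∷ z ∷ flatten M₂ ++ [ t ]       ≡⟨ ++-assoc (flatten M₁) (s ∷ g ∷ []) _ ⟨
      (flatten M₁ ++ s ∷ g ∷ []) ++ z ∷ flatten M₂ ++ [ t ] ≡⟨ cong₂ (λ U V → U ++ z ∷ V) eq₁ eq₂ ⟩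
      s' ∷ P ++ z ∷ t' ∷ Q ∎

  -- The vertex `h` has attachments on both sides, and a vertex in a gap of size at most two has one
  -- on some side. So `crossing` or its mirror image applies to every other gap vertex.
  Single⇒Iso : ∀ {t h} M → RotB (block t h [] ∷ M) → N t → (N h → A) →
    All (λ b → Good b × AtMostTwo b) M → Iso h
  Single⇒Iso {t} {h} M rot nt ¬nh props w∈ ¬nw w≢h conn
    with Perm.∈-resp-↭ (↭-sym (proj₂ rot)) w∈
  ... | here refl = ¬nw nt
  ... | there (here w≡h) = contradiction w≡h w≢h
  ... | there (there w∈M)
    with M₁ , block s g gs , M₂ , refl , pos ← ∈-flatten M w∈M
    with props₁ , ((ns , _) , two) ∷ props₂ ← All.++⁻ M₁ props
    with gs | two | pos
  ... | _ | _ | inj₁ refl = ¬nw ns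
  ... | _ | _ | inj₂ (inj₁ refl) =
          crossing (flatten M₁) (subst (λ L → Rot (t ∷ h ∷ L)) (flatten-++ M₁) rot) nt ns ¬nh conn
  ... | z ∷ [] | _ | inj₂ (inj₂ (here refl)) =
          mirrored-block-crossing M₁ rot (All.map proj₁ props₁) (All.map proj₁ props₂) nt ns ¬nh conn
  ... | _ ∷ _ ∷ _ | s≤s () | inj₂ (inj₂ _)

  -- Each block is rotated to the front in turn; `done` collects those already treated.
  firsts-Iso : ∀ B done → RotB (B ++ done) → All Single B →
    All (λ b → Good b × AtMostTwo b) (B ++ done) → All Iso (map first B)
  firsts-Iso [] _ _ _ _ = []
  firsts-Iso (b@(block t h []) ∷ B) done rot (_ ∷ single) (p@((nt , ¬nh , _) , _) ∷ props) =
    Single⇒Iso (B ++ done) rot nt ¬nh props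
    ∷ firsts-Iso B (done ++ [ b ]) (subst RotB (++-assoc B done [ b ]) (RotB-rotate [ b ] rot)) single
        (subst (All _) (++-assoc B done [ b ]) (All.++⁺ props (p ∷ [])))

  attachments-complete : ∀ {B} → RotB B → All Good B →
    ∀ {w} → w ∈ C₀ → w ∉ map attachment B → N w → A
  attachments-complete {B} rot good w∈ w∉ nw
    with B₁ , b , B₂ , refl , pos ← ∈-flatten B (Perm.∈-resp-↭ (↭-sym (proj₂ rot)) w∈)
    with _ , (_ , ¬ng , ¬gs) ∷ _ ← All.++⁻ B₁ good
    with pos
  ... | inj₁ refl = contradiction (∈-map⁺ attachment (∈-insert B₁)) w∉
  ... | inj₂ (inj₁ refl) = ¬ng nw
  ... | inj₂ (inj₂ w∈gs) = All.lookup ¬gs w∈gs nw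

  firsts-good : ∀ {B} → RotB B → All Good B → All (λ h → h ∈ C₀ × (N h → A)) (map first B)
  firsts-good {B} rot good = All.map⁺ (All.tabulate λ b∈ →
    Rot-∈ rot (Sublist.lookup (firsts-⊆ B) (∈-map⁺ first b∈)) , proj₁ (proj₂ (All.lookup good b∈)))

  -- Cases by the number of blocks

  few-blocks : ∀ {k} b B → RotB (b ∷ B) → All Good (b ∷ B) → KOrdered G k → k ≤ n →
    2 + length (b ∷ B) ≤ k → A
  few-blocks {k} b B rot good ko k≤n le = few-attachments ko k≤n
    (subst (λ l → 2 + l ≤ k) (sym (length-map attachment (b ∷ B))) le)
    (Unique-⊆ (attachments-⊆ (b ∷ B)) (Rot-unique rot))
    (λ v∈ → Rot-∈ rot (Sublist.lookup (attachments-⊆ (b ∷ B)) v∈))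
    (All.map⁺ (All.map proj₁ good))
    (proj₁ (All.head (firsts-good rot good))) (proj₂ (All.head (firsts-good rot good)))
    where open Separator (map attachment (b ∷ B)) (attachments-complete rot good)

  many-blocks : ∀ b B → RotB (b ∷ B) → All Good (b ∷ B) → All Single B → AtMostTwo b →
    KOrdered G (suc (length (b ∷ B))) → A
  many-blocks b B rot good single two ko = many-attachments (map first B)
    (subst (λ l → KOrdered G (2 + l)) (sym (length-map first B)) ko)
    (≤-reflexive (trans (length-map attachment (b ∷ B)) (cong suc (sym (length-map first B)))))
    (Unique-⊆ (firsts-⊆ (b ∷ B)) (Rot-unique rot))
    (firsts-Iso B [ b ] (RotB-rotate [ b ] rot) single
      (All.++⁺ (All.zip (All.tail good , All.map (λ { refl → z≤n }) single)) ((All.head good , two) ∷ [])))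
    (firsts-good rot good)
    where open Separator (map attachment (b ∷ B)) (attachments-complete rot good)

  tight-blocks : ∀ b B → RotB (b ∷ B) → All Good (b ∷ B) → KOrdered G (suc (length (b ∷ B))) →
    length C₀ ≤ suc (length (b ∷ B) + length (b ∷ B)) → A
  tight-blocks b B rot good ko short
    with B₁ , b' , B₂ , eq , s₁ , s₂ , two ← one-long b B
           (≤-trans (≤-reflexive (Perm.↭-length (proj₂ rot))) short) =
      -- The possibly long gap is rotated to the front, the place where no isolation is required.
      many-blocks b' (B₂ ++ B₁) (RotB-rotate B₁ (subst RotB eq rot))
        (Perm.All-resp-↭ rotated good) (All.++⁺ s₂ s₁) two
        (subst (KOrdered G ∘ suc) (Perm.↭-length rotated) ko)
    where
    rotated : b ∷ B ↭ b' ∷ B₂ ++ B₁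
    rotated = subst (_↭ b' ∷ B₂ ++ B₁) (sym eq) (Perm.++-comm B₁ (b' ∷ B₂))

  from-blocks : ∀ {k} b B → RotB (b ∷ B) → All Good (b ∷ B) → KOrdered G k → k ≤ n →
    length C₀ < k + k → A
  from-blocks {k} b B rot good ko k≤n short with 2 + length (b ∷ B) ≤? k
  ... | yes le = few-blocks b B rot good ko k≤n le
  ... | no ¬le = tight-blocks b B rot good (subst (KOrdered G) k≡ ko)
          (≤-trans (s≤s⁻¹ (subst (λ l → length C₀ < l + l) k≡ short))
            (≤-reflexive (+-suc (length (b ∷ B)) (length (b ∷ B)))))
    where
    k≡ : k ≡ suc (length (b ∷ B))
    -- With at least `k` blocks, `C₀` would have at least `k + k` vertices.
    k≡ = ≤-antisym (s≤s⁻¹ (≰⇒> ¬le)) (≰⇒> λ k≤ → <⇒≱ short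
      (≤-trans (+-mono-≤ k≤ k≤)
        (≤-trans (length-flatten-≥ (b ∷ B)) (≤-reflexive (Perm.↭-length (proj₂ rot))))))

  from-attachment : ∀ {k} s cs → Rot (s ∷ cs) → N s → All DecN cs →
    KOrdered G k → k ≤ n → length C₀ < k + k → A
  from-attachment s [] (edge e , _) = ⊥-elim (irrefl G e)
  from-attachment s (c ∷ cs) rot ns ds ko k≤n short
    -- The cycle closes up at `s`, so `s` is also the vertex `s₀` after the list.
    with parse s (c ∷ cs) ns ns (no-consecutive rot ∷ linked cs (Rot-rotate [ s ] rot)) ds
  ... | inj₁ a = a
  ... | inj₂ (b , B , eq , good) = from-blocks b B (subst Rot (sym eq) rot) good ko k≤n short

  -- Since the goal is `A`, one may decide `N c`: `f` is run on the negative answer, and a proof of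
  -- `N c` fed to it reruns `f` on the positive one.
  classify : ∀ xs → (All DecN xs → A) → A
  classify []       f = f []
  classify (c ∷ xs) f = classify xs λ ds → f (inj₂ (λ nc → f (inj₁ nc ∷ ds)) ∷ ds)

  find-attachment : ∀ {xs} → All DecN xs →
    All (λ c → N c → A) xs ⊎ ∃[ c ] c ∈ xs × N c
  find-attachment [] = inj₁ []
  find-attachment (inj₁ nc ∷ ds) = inj₂ (_ , here refl , nc)
  find-attachment (inj₂ ¬nc ∷ ds) with find-attachment ds
  ... | inj₁ none = inj₁ (¬nc ∷ none)
  ... | inj₂ (c , c∈ , nc) = inj₂ (c , there c∈ , nc)

  no-attachments : ∀ {k L} → Rot L → All (λ c → N c → A) L → KOrdered G k → 2 ≤ k → k ≤ n → A
  no-attachments {L = c ∷ L} rot none@(¬nc ∷ _) ko 2≤k k≤n =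
    few-attachments ko k≤n 2≤k [] (λ ()) [] (Rot-∈ rot (here refl)) ¬nc
    where open Separator [] (λ w∈ _ → All.lookup (Perm.All-resp-↭ (proj₂ rot) none) w∈)

  improve : ∀ {k} → Closed C₀ → KOrdered G k → 2 ≤ k → k ≤ n → length C₀ < k + k → A
  improve closed ko 2≤k k≤n short = classify C₀ λ ds → case find-attachment ds of λ where
    (inj₁ none) → no-attachments (closed , ↭-refl) none ko 2≤k k≤n
    (inj₂ (s , s∈ , ns)) →
      let as , bs , eq = ∈-∃++ s∈
          rot = Rot-rotate as (subst Rot eq (closed , ↭-refl))
      in from-attachment s (bs ++ as) rot ns (All.tail (Perm.All-resp-↭ (↭-sym (proj₂ rot)) ds))
           ko k≤n short

-- Growing a cycle to the required length

theorem2 : (n : ℕ) (G : SimpleGraph n) (k : ℕ) → 2 ≤ k → k ≤ n → KOrdered G k →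
    CircumferenceAtLeast G (n ⊓ (2 * k))
theorem2 n G k 2≤k k≤n ko =
  -- The initial cycle is one through the first `k` vertices.
  let m , C , _ = ko (λ i → inject≤ i k≤n) (inject≤-injective k≤n k≤n _ _)
  in grow _ C (m≤n+m _ m)
  where
  open Walks G
  -- Recursion on `d`, a bound on the length still missing; every improvement adds at least one
  -- vertex and uses up one unit. The target length itself serves as the initial bound.
  grow : ∀ d {m} → Cycle G m → n ⊓ (2 * k) ≤ m + d → CircumferenceAtLeast G (n ⊓ (2 * k))
  grow d {m} C le with n ⊓ (2 * k) ≤? m
  ... | yes long = m , long , C
  grow zero {m} C le | no short = contradiction (subst (_ ≤_) (+-identityʳ m) le) short
  grow (suc d) {m} C le | no short =
    let x , x∉ = fresh C₀ (subst (_< n) (sym len) (m<n⊓o⇒m<n _ _ (≰⇒> short)))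
    in Improve.improve G _ C₀ (cycle→unique C) longer x x∉ (cycle→closed C) ko 2≤k k≤n
         (subst₂ _<_ (sym len) (cong (k +_) (+-identityʳ k)) (m<n⊓o⇒m<o n _ (≰⇒> short)))
    where
    C₀ = tabulate (vert C)
    len : length C₀ ≡ m
    len = length-tabulate (vert C)
    longer : ∀ {L} → Closed L → Unique L → length C₀ < length L → CircumferenceAtLeast G (n ⊓ (2 * k))
    longer {L} p u lt = grow d (list→cycle p u (≤-trans (len≥3 C) (<⇒≤ m<))) (begin
      n ⊓ (2 * k)   ≤⟨ le ⟩
      m + suc d     ≡⟨ +-suc m d ⟩
      suc m + d     ≤⟨ +-monoˡ-≤ d m< ⟩
      length L + d  ∎)
      where
      open ≤-Reasoning
      m< : m < length L
      m< = subst (_< length L) len lt
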